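{- Let $g(d)$ denote the smallest integer such that for every finite set $S\subset\mathbb{R}^d$ there is a subset $P\subseteq S$ with $|P|\le g(d)$ such that every $s\in S$ lies in $box(p,q)$ for some $p,q\in P$. Then $g(d)=O\!\left(2^{2^{d-1}}\,d\log d\right)$.
   Context: For $p,q\in\mathbb{R}^d$, $box(p,q)=\{x\in\mathbb{R}^d : \min(p_i,q_i)\le x_i\le \max(p_i,q_i)\text{ for all } i\}$ is the smallest closed axis-parallel box containing $p$ and $q$. -}

module Defs where

open import Level using (Level)
open import Data.Nat using (ℕ; _+_; _*_; _∸_; _^_)
open import Data.Nat.Logarithm using (⌊log₂_⌋)
open import Data.Fin using (Fin)
open import Data.List using (List; length)
open import Data.List.Membership.Propositional using (_∈_)
open import Data.Product using (Σ; ∃; _×_; _,_)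
open import Data.Sum using (_⊎_)
open import Relation.Binary.Bundles using (TotalOrder)

-- Coordinates live in an arbitrary total order O (instantiate O := (ℝ, ≤)).
module Boxes {c ℓ₁ ℓ₂ : Level} (O : TotalOrder c ℓ₁ ℓ₂) where
  open TotalOrder O renaming (Carrier to R)

  Point : ℕ → Set c
  Point d = Fin d → R

  -- x ∈ box(p,q):  min(p_i,q_i) ≤ x_i ≤ max(p_i,q_i) for every coordinate i
  InBox : ∀ {d} → Point d → Point d → Point d → Set ℓ₂
  InBox p q x = ∀ i → (p i ≤ x i × x i ≤ q i) ⊎ (q i ≤ x i × x i ≤ p i)

  BoxCover : ∀ {d} → List (Point d) → List (Point d) → Set (Level._⊔_ c ℓ₂)
  BoxCover S P =
    (∀ {p} → p ∈ P → p ∈ S) ×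
    (∀ {s} → s ∈ S → Σ (Point _) λ p → Σ (Point _) λ q → p ∈ P × q ∈ P × InBox p q s)

-- the bound 2^(2^(d-1)) · d · log d  (log taken as ⌊log₂ d⌋, up to a constant factor)
bound : ℕ → ℕ
bound d = 2 ^ (2 ^ (d ∸ 1)) * d * ⌊log₂ d ⌋

{-# OPTIONS --safe #-}
-- Choose one quadrant from each of the 2^(d-1) antipodal pairs; there are 2^(2^(d-1)) choices. Each
-- choice defines a tournament on S in which u beats v when u lies in a chosen quadrant of v, and P is
-- the union of dominating sets of these tournaments: if s were in no box of P, then in every antipodal
-- pair some quadrant at s would contain no point of P, and the tournament of these empty quadrants
-- would leave s undominated.
--
-- A dominating set of size O(d log d) is found in two steps. Multiplicative weights give a list U in
-- which every vertex is beaten by a constant fraction of the members. Cutting each coordinate into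
-- O(d) blocks that contain few members of U splits the points into O(d)^d cells, and all points of a
-- cell are beaten by a common constant fraction of U, so that greedily chosen members of U hit the
-- dominators of every cell after O(log (O(d)^d)) steps.
module Submission where

open import Defs
open import Level using (Level)
open import Data.Bool using (Bool; true; false; not; _∧_; if_then_else_)
open import Data.Bool.Properties as Boolₚ using (T-≡; T?; ¬-not; not-involutive)
open import Data.Empty using (⊥-elim)
open import Data.Fin using (Fin; zero; suc)
open import Data.Fin.Properties as Finₚ using (all?)
open import Data.List as List using
  (List; []; _∷_; length; map; filter; filterᵇ; concatMap; allFin; upTo; cartesianProductWith)
open import Data.List.Extrema.Nat using (argmax; argmin; argmax-sel; argmin-sel; f[xs]≤f[argmax]; f[argmin]≤f[xs])
open import Data.List.Membership.Propositional using (_∈_; find; lose)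
open import Data.List.Membership.Propositional.Properties
import Data.List.Properties as Listₚ
open import Data.List.Relation.Unary.All as All using (All)
open import Data.List.Relation.Unary.Any as Any using (Any; here; there; any?)
open import Data.List.Relation.Unary.Any.Properties using (lookup-index)
open import Data.Nat
open import Data.Nat.DivMod using (m*n/n≡m; m/n*n≤m; /-monoˡ-≤; m<n*o⇒m/o<n)
open import Data.Nat.Logarithm using (⌊log₂_⌋; ⌊log₂⌋-mono-≤; ⌊log₂[2^n]⌋≡n)
open import Data.Nat.Properties
open import Data.Nat.Tactic.RingSolver using (solve-∀)
open import Data.Product as Product using (Σ; ∃; _×_; _,_; proj₁; proj₂)
open import Data.Sum as Sum using (_⊎_; inj₁; inj₂; [_,_]′)
open import Data.Vec as Vec using (Vec; []; _∷_; lookup; replicate; tabulate)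
import Data.Vec.Properties as Vecₚ
open import Function using (_∘_; id)
open import Function.Bundles using (Equivalence)
open import Relation.Binary.Bundles using (TotalOrder)
open import Relation.Binary.Definitions using (tri<; tri≈; tri>)
open import Relation.Binary.PropositionalEquality
open import Relation.Nullary using (¬_; Dec; yes; no; does; contradiction)
open import Relation.Nullary.Decidable using (dec-true)

private
  variable
    a b : Level
    A : Set a
    B : Set b

-- Sums and counts over finite lists.

∑ : List A → (A → ℕ) → ℕ
∑ []       f = 0
∑ (x ∷ xs) f = f x + ∑ xs f

bit : Bool → ℕ
bit true  = 1
bit false = 0

count : (A → Bool) → List A → ℕ
count p xs = ∑ xs (bit ∘ p)

∑-cong : ∀ (xs : List A) {f g : A → ℕ} → (∀ x → f x ≡ g x) → ∑ xs f ≡ ∑ xs g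
∑-cong []       f≡g = refl
∑-cong (x ∷ xs) f≡g = cong₂ _+_ (f≡g x) (∑-cong xs f≡g)

∑-mono : ∀ (xs : List A) {f g : A → ℕ} → (∀ {x} → x ∈ xs → f x ≤ g x) → ∑ xs f ≤ ∑ xs g
∑-mono []       f≤g = z≤n
∑-mono (x ∷ xs) f≤g = +-mono-≤ (f≤g (here refl)) (∑-mono xs (f≤g ∘ there))

+-interchange : ∀ m n o p → (m + n) + (o + p) ≡ (m + o) + (n + p)
+-interchange = solve-∀

∑-+ : ∀ (xs : List A) (f g : A → ℕ) → ∑ xs (λ x → f x + g x) ≡ ∑ xs f + ∑ xs g
∑-+ []       f g = refl
∑-+ (x ∷ xs) f g = trans (cong (f x + g x +_) (∑-+ xs f g)) (+-interchange (f x) (g x) _ _)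

∑-*ˡ : ∀ (xs : List A) k (f : A → ℕ) → ∑ xs (λ x → k * f x) ≡ k * ∑ xs f
∑-*ˡ []       k f = sym (*-zeroʳ k)
∑-*ˡ (x ∷ xs) k f = trans (cong (k * f x +_) (∑-*ˡ xs k f)) (sym (*-distribˡ-+ k (f x) _))

∑-*ʳ : ∀ (xs : List A) (f : A → ℕ) k → ∑ xs (λ x → f x * k) ≡ ∑ xs f * k
∑-*ʳ []       f k = refl
∑-*ʳ (x ∷ xs) f k = trans (cong (f x * k +_) (∑-*ʳ xs f k)) (sym (*-distribʳ-+ k (f x) _))

∑-const : ∀ (xs : List A) k → ∑ xs (λ _ → k) ≡ length xs * k
∑-const []       k = refl
∑-const (x ∷ xs) k = cong (k +_) (∑-const xs k)

∑-swap : ∀ (xs : List A) (ys : List B) (f : A → B → ℕ) →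
         ∑ xs (λ x → ∑ ys (f x)) ≡ ∑ ys (λ y → ∑ xs (λ x → f x y))
∑-swap []       ys f = sym (trans (∑-const ys 0) (*-zeroʳ (length ys)))
∑-swap (x ∷ xs) ys f = trans (cong (∑ ys (f x) +_) (∑-swap xs ys f)) (sym (∑-+ ys (f x) _))

∈⇒≤∑ : ∀ {xs : List A} {x} (f : A → ℕ) → x ∈ xs → f x ≤ ∑ xs f
∈⇒≤∑ f (here refl) = m≤m+n _ _
∈⇒≤∑ f (there x∈) = ≤-trans (∈⇒≤∑ f x∈) (m≤n+m _ _)

count-complement : ∀ (p : A → Bool) xs → count (not ∘ p) xs + count p xs ≡ length xs
count-complement p []       = refl
count-complement p (x ∷ xs) =
  trans (+-interchange (bit (not (p x))) _ _ _) (cong₂ _+_ (once (p x)) (count-complement p xs))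
  where
  once : ∀ b → bit (not b) + bit b ≡ 1
  once true  = refl
  once false = refl

count>0⇒∃ : ∀ (p : A → Bool) xs → 0 < count p xs → ∃ λ x → x ∈ xs × p x ≡ true
count>0⇒∃ p (x ∷ xs) 0<c with p x in eq
... | true  = x , here refl , eq
... | false with y , y∈ , py ← count>0⇒∃ p xs 0<c = y , there y∈ , py

bit-≤ : ∀ {p k} → (p ≡ true → 1 ≤ k) → bit p ≤ k
bit-≤ {true}  h = h refl
bit-≤ {false} h = z≤n

abstract
  ∃-argmax : ∀ (f : A → ℕ) x xs → ∃ λ m → m ∈ x ∷ xs × (∀ {y} → y ∈ x ∷ xs → f y ≤ f m)
  ∃-argmax f x xs = argmax f x (x ∷ xs) , [ here , id ]′ (argmax-sel f x (x ∷ xs)) ,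
    All.lookup (f[xs]≤f[argmax] {f = f} x (x ∷ xs))

  ∃-argmin : ∀ (f : A → ℕ) x xs → ∃ λ m → m ∈ x ∷ xs × (∀ {y} → y ∈ x ∷ xs → f m ≤ f y)
  ∃-argmin f x xs = argmin f x (x ∷ xs) , [ here , id ]′ (argmin-sel f x (x ∷ xs)) ,
    All.lookup (f[argmin]≤f[xs] {f = f} x (x ∷ xs))

-- Averaging and multiplicative weights.

weighted-pigeonhole : ∀ (x₀ : A) xs (w f : A → ℕ) k c → let ys = x₀ ∷ xs in
                      ∑ ys w * c ≤ k * ∑ ys (λ x → w x * f x) →
                      0 < ∑ ys w → ∃ λ x → c ≤ k * f x
-- The witness is a maximiser of `f`, whose value is at least the `w`-weighted average.
weighted-pigeonhole x₀ xs w f k c h 0<W with ∃-argmax f x₀ xs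
... | m , _ , max = m , *-cancelˡ-≤ W {{>-nonZero 0<W}} (begin
  W * c                             ≤⟨ h ⟩
  k * ∑ ys (λ x → w x * f x)        ≤⟨ *-monoʳ-≤ k (∑-mono ys (λ {x} x∈ → *-monoʳ-≤ (w x) (max x∈))) ⟩
  k * ∑ ys (λ x → w x * f m)        ≡⟨ cong (k *_) (∑-*ʳ ys w (f m)) ⟩
  k * (W * f m)                     ≡⟨ rearrange k W (f m) ⟩
  W * (k * f m)                     ∎)
  where
  open ≤-Reasoning
  ys = x₀ ∷ xs
  W = ∑ ys w
  rearrange : ∀ p q r → p * (q * r) ≡ q * (p * r)
  rearrange = solve-∀

-- The weight of q doubles whenever the chosen element misses q, so choosing an element that hits a
-- 1/k fraction of the weight multiplies the total by at most (2k - 1)/k = l/k.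
multiplicative-weights :
  ∀ (H : A → B → Bool) (Q : List B) k l → suc l ≡ 2 * k →
  (∀ (w : B → ℕ) → ∃ λ u → ∑ Q w ≤ k * ∑ Q (λ q → w q * bit (H u q))) →
  ∀ j → ∃ λ U → length U ≡ j ×
    k ^ j * ∑ Q (λ q → 2 ^ count (λ u → not (H u q)) U) ≤ l ^ j * length Q
multiplicative-weights H Q k l 1+l≡2k avg zero =
  [] , refl , *-monoʳ-≤ 1 (≤-reflexive (trans (∑-const Q 1) (*-identityʳ _)))
multiplicative-weights H Q k l 1+l≡2k avg (suc j)
  with multiplicative-weights H Q k l 1+l≡2k avg j
... | U , len , ih with avg (λ q → 2 ^ count (λ u → not (H u q)) U)
... | u , hit = u ∷ U , cong suc len , (begin
  k * k ^ j * X′         ≡⟨ r₁ k (k ^ j) X′ ⟩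
  k ^ j * (k * X′)       ≤⟨ *-monoʳ-≤ (k ^ j) step ⟩
  k ^ j * (l * X)        ≡⟨ r₂ (k ^ j) l X ⟩
  l * (k ^ j * X)        ≤⟨ *-monoʳ-≤ l ih ⟩
  l * (l ^ j * length Q) ≡⟨ *-assoc l _ _ ⟨
  l * l ^ j * length Q   ∎)
  where
  open ≤-Reasoning
  w = λ q → 2 ^ count (λ u → not (H u q)) U
  w′ = λ q → 2 ^ count (λ u → not (H u q)) (u ∷ U)
  h = λ q → w q * bit (H u q)
  X = ∑ Q w
  X′ = ∑ Q w′
  Y = ∑ Q h
  r₁ : ∀ p q r → p * q * r ≡ q * (p * r)
  r₁ = solve-∀
  r₂ : ∀ p q r → p * (q * r) ≡ q * (p * r)
  r₂ = solve-∀
  pointwise : ∀ q → w′ q + h q ≡ 2 * w q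
  pointwise q with H u q
  ... | true  = cong (w q +_) (*-comm (w q) 1)
  ... | false = trans (cong (2 * w q +_) (*-zeroʳ (w q))) (+-identityʳ _)
  total : X′ + Y ≡ 2 * X
  total = trans (sym (∑-+ Q w′ h)) (trans (∑-cong Q pointwise) (∑-*ˡ Q 2 w))
  step : k * X′ ≤ l * X
  step = +-cancelˡ-≤ X _ _ (begin
    X + k * X′       ≤⟨ +-monoˡ-≤ (k * X′) hit ⟩
    k * Y + k * X′   ≡⟨ r₃ k Y X′ ⟩
    k * (X′ + Y)     ≡⟨ cong (k *_) total ⟩
    k * (2 * X)      ≡⟨ r₄ k X ⟩
    2 * k * X        ≡⟨ cong (_* X) 1+l≡2k ⟨
    X + l * X        ∎)
    where
    r₃ : ∀ p q r → p * q + p * r ≡ p * (r + q)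
    r₃ = solve-∀
    r₄ : ∀ p q → p * (2 * q) ≡ 2 * p * q
    r₄ = solve-∀

-- Numerical estimates for powers.

n<2^n : ∀ n → n < 2 ^ n
n<2^n zero    = z<s
n<2^n (suc n) = ≤-trans (+-mono-≤ (m^n>0 2 n) (n<2^n n)) (+-monoʳ-≤ (2 ^ n) (m≤m+n _ 0))

^-distribʳ-* : ∀ e m n → (m * n) ^ e ≡ m ^ e * n ^ e
^-distribʳ-* zero    m n = refl
^-distribʳ-* (suc e) m n = trans (cong (m * n *_) (^-distribʳ-* e m n)) (r m n _ _)
  where
  r : ∀ p q r s → p * q * (r * s) ≡ p * r * (q * s)
  r = solve-∀

^-growth : ∀ x y z j e → x ^ j * z ≤ y ^ j → x ^ (j * e) * z ^ e ≤ y ^ (j * e)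
^-growth x y z j e h = begin
  x ^ (j * e) * z ^ e ≡⟨ cong (_* z ^ e) (^-*-assoc x j e) ⟨
  (x ^ j) ^ e * z ^ e ≡⟨ ^-distribʳ-* e (x ^ j) z ⟨
  (x ^ j * z) ^ e     ≤⟨ ^-monoˡ-≤ e h ⟩
  (y ^ j) ^ e         ≡⟨ ^-*-assoc y j e ⟩
  y ^ (j * e)         ∎
  where open ≤-Reasoning

-- Since `(16/15)^11 ≥ 2`, eleven rounds at hit rate 1/8 pay for one factor 2; hence the dominating
-- sets of size `11 * e`.
15^11e*2^e≤16^11e : ∀ e → 15 ^ (11 * e) * 2 ^ e ≤ 16 ^ (11 * e)
15^11e*2^e≤16^11e e = ^-growth 15 16 2 11 e (≤ᵇ⇒≤ (15 ^ 11 * 2) (16 ^ 11) _)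

3^4e≤2^7e : ∀ e → 3 ^ (4 * e) ≤ 2 ^ (7 * e)
3^4e≤2^7e e = subst₂ _≤_ (^-*-assoc 3 4 e) (^-*-assoc 2 7 e) (^-monoˡ-≤ e (≤ᵇ⇒≤ 81 128 _))

-- Fractional domination in tournaments.

module _ {A : Set a} (D : A → A → Bool) (complete : ∀ u v → D u v ≡ true ⊎ D v u ≡ true) where

  -- Every product w u * w v is counted for at least one of the two orientations of {u, v}.
  tournament-average : ∀ (V : List A) (w : A → ℕ) →
    ∑ V w * ∑ V w ≤ 2 * ∑ V (λ u → w u * ∑ V (λ v → w v * bit (D u v)))
  tournament-average V w = begin
    X * X
      ≡⟨ ∑-*ʳ V w X ⟨
    ∑ V (λ u → w u * X)
      ≡⟨ ∑-cong V (λ u → sym (∑-*ˡ V (w u) w)) ⟩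
    ∑ V (λ u → ∑ V (λ v → w u * w v))
      ≤⟨ ∑-mono V (λ {u} _ → ∑-mono V (λ {v} _ → pair u v)) ⟩
    ∑ V (λ u → ∑ V (λ v → S u v + S v u))
      ≡⟨ ∑-cong V (λ u → ∑-+ V (S u) (λ v → S v u)) ⟩
    ∑ V (λ u → ∑ V (S u) + ∑ V (λ v → S v u))
      ≡⟨ ∑-+ V (λ u → ∑ V (S u)) (λ u → ∑ V (λ v → S v u)) ⟩
    Y + ∑ V (λ u → ∑ V (λ v → S v u))
      ≡⟨ cong (Y +_) (∑-swap V V (λ u v → S v u)) ⟩
    Y + Y
      ≡⟨ cong (Y +_) (+-identityʳ Y) ⟨
    2 * Y
      ≡⟨ cong (2 *_) (∑-cong V (λ u → ∑-*ˡ V (w u) _)) ⟩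
    2 * ∑ V (λ u → w u * ∑ V (λ v → w v * bit (D u v)))
      ∎
    where
    open ≤-Reasoning
    X = ∑ V w
    S : A → A → ℕ
    S u v = w u * (w v * bit (D u v))
    Y = ∑ V (λ u → ∑ V (S u))
    pair : ∀ u v → w u * w v ≤ S u v + S v u
    pair u v with complete u v
    ... | inj₁ eq rewrite eq = ≤-trans (≤-reflexive (cong (w u *_) (sym (*-identityʳ (w v))))) (m≤m+n _ _)
    ... | inj₂ eq rewrite eq =
      ≤-trans (≤-reflexive (trans (*-comm (w u) (w v)) (cong (w v *_) (sym (*-identityʳ (w u)))))) (m≤n+m _ _)

  -- By `tournament-average` the weighted average of the dominated weight is at least half the
  -- total. If the total is zero, any vertex serves.
  heavy-dominator : ∀ v₀ vs (w : A → ℕ) → let V = v₀ ∷ vs in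
    ∃ λ u → ∑ V w ≤ 2 * ∑ V (λ v → w v * bit (D u v))
  heavy-dominator v₀ vs w with ∑ (v₀ ∷ vs) w in eq
  ... | zero  = v₀ , z≤n
  ... | suc X = weighted-pigeonhole v₀ vs w (λ u → ∑ V (λ v → w v * bit (D u v))) 2 (suc X)
      (subst (λ z → ∑ V w * z ≤ 2 * ∑ V (λ u → w u * ∑ V (λ v → w v * bit (D u v)))) eq
        (tournament-average V w))
      (subst (0 <_) (sym eq) z<s)
    where V = v₀ ∷ vs

  -- At hit rate 1/2 the total weight after `4 * q` rounds is at most `(3/2)^(4q) |V|`, which is
  -- below `2^(3q + |V|)` because `81 ≤ 128`. So a vertex is missed fewer than `3q + |V|` times and
  -- beaten in all other rounds. The crude estimate `|V| < 2^|V|` is harmless: the length of `U`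
  -- does not enter the final bound.
  fractional-domination : ∀ v₀ vs q → let V = v₀ ∷ vs in
    ∃ λ U → length U ≡ 4 * q × (∀ {v} → v ∈ V → q ≤ count (λ u → D u v) U + length V)
  fractional-domination v₀ vs q
    with multiplicative-weights D (v₀ ∷ vs) 2 3 refl (heavy-dominator v₀ vs) (4 * q)
  ... | U , len , bound = U , len , dominated
    where
    V = v₀ ∷ vs
    n = length V
    dominated : ∀ {v} → v ∈ V → q ≤ count (λ u → D u v) U + n
    dominated {v} v∈ = <⇒≤ (+-cancelˡ-< (7 * q) _ _ (begin-strict
      7 * q + q                    ≡⟨ r₁ q ⟩
      4 * q + 4 * q                ≡⟨ cong (4 * q +_) (trans (sym len) (sym (count-complement (λ u → D u v) U))) ⟩
      4 * q + (k + m)              ≡⟨ +-assoc (4 * q) k m ⟨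
      4 * q + k + m                <⟨ +-monoˡ-< m exponents ⟩
      7 * q + n + m                ≡⟨ r₂ (7 * q) n m ⟩
      7 * q + (m + n)              ∎))
      where
      open ≤-Reasoning
      m = count (λ u → D u v) U
      k = count (λ u → not (D u v)) U
      weight = λ v → 2 ^ count (λ u → not (D u v)) U
      r₁ : ∀ q → 7 * q + q ≡ 4 * q + 4 * q
      r₁ = solve-∀
      r₂ : ∀ x y z → x + y + z ≡ x + (z + y)
      r₂ = solve-∀
      powers : 2 ^ (4 * q + k) < 2 ^ (7 * q + n)
      powers = begin-strict
        2 ^ (4 * q + k)              ≡⟨ ^-distribˡ-+-* 2 (4 * q) k ⟩
        2 ^ (4 * q) * 2 ^ k          ≤⟨ *-monoʳ-≤ (2 ^ (4 * q)) (∈⇒≤∑ weight v∈) ⟩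
        2 ^ (4 * q) * ∑ V weight     ≤⟨ bound ⟩
        3 ^ (4 * q) * n              ≤⟨ *-monoˡ-≤ n (3^4e≤2^7e q) ⟩
        2 ^ (7 * q) * n              <⟨ *-monoʳ-< (2 ^ (7 * q)) {{m^n≢0 2 (7 * q)}} (n<2^n n) ⟩
        2 ^ (7 * q) * 2 ^ n          ≡⟨ ^-distribˡ-+-* 2 (7 * q) n ⟨
        2 ^ (7 * q + n)              ∎
      exponents : 4 * q + k < 7 * q + n
      exponents = ≰⇒> λ ge → <⇒≱ powers (^-monoʳ-≤ 2 ge)

-- Hitting sets for dense relations.

dense⇒average-hit : ∀ (H : A → B → Bool) u₀ us (Q : List B) → let U = u₀ ∷ us in
  (∀ {q} → q ∈ Q → length U ≤ 8 * count (λ u → H u q) U) →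
  ∀ w → ∃ λ u → ∑ Q w ≤ 8 * ∑ Q (λ q → w q * bit (H u q))
-- Double counting: all members of `U` get weight 1, and each `q` is hit by at least an eighth of
-- them.
dense⇒average-hit H u₀ us Q dense w = weighted-pigeonhole u₀ us (λ _ → 1) f 8 (∑ Q w) (begin
  ∑ U (λ _ → 1) * ∑ Q w                         ≡⟨ cong (_* ∑ Q w) (trans (∑-const U 1) (*-identityʳ (length U))) ⟩
  length U * ∑ Q w                              ≡⟨ ∑-*ˡ Q (length U) w ⟨
  ∑ Q (λ q → length U * w q)                    ≤⟨ ∑-mono Q (λ {q} q∈ → *-monoˡ-≤ (w q) (dense q∈)) ⟩
  ∑ Q (λ q → 8 * count (λ u → H u q) U * w q)   ≡⟨ ∑-cong Q (λ q → r (count (λ u → H u q) U) (w q)) ⟩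
  ∑ Q (λ q → 8 * (w q * count (λ u → H u q) U)) ≡⟨ ∑-*ˡ Q 8 _ ⟩
  8 * ∑ Q (λ q → w q * count (λ u → H u q) U)   ≡⟨ cong (8 *_) (∑-cong Q (λ q → sym (∑-*ˡ U (w q) _))) ⟩
  8 * ∑ Q (λ q → ∑ U (λ u → w q * bit (H u q))) ≡⟨ cong (8 *_) (∑-swap Q U _) ⟩
  8 * ∑ U f                                     ≡⟨ cong (8 *_) (∑-cong U (λ u → sym (*-identityˡ (f u)))) ⟩
  8 * ∑ U (λ u → 1 * f u)                       ∎) z<s
  where
  open ≤-Reasoning
  U = u₀ ∷ us
  f = λ u → ∑ Q (λ q → w q * bit (H u q))
  r : ∀ x y → 8 * x * y ≡ 8 * (y * x)
  r = solve-∀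

-- An element missed by all `j` choices keeps weight `2^j`, while the total is at most `(15/8)^j N`;
-- the quotient `(16/15)^j` is at least `2^e`.
unhit⇒large : ∀ j e X N → 15 ^ j * 2 ^ e ≤ 16 ^ j → 2 ^ j ≤ X → 8 ^ j * X ≤ 15 ^ j * N → 2 ^ e ≤ N
unhit⇒large j e X N growth j≤X bound = *-cancelˡ-≤ (15 ^ j) {{m^n≢0 15 j}} (begin
  15 ^ j * 2 ^ e    ≤⟨ growth ⟩
  16 ^ j            ≡⟨ ^-distribʳ-* j 8 2 ⟩
  8 ^ j * 2 ^ j     ≤⟨ *-monoʳ-≤ (8 ^ j) j≤X ⟩
  8 ^ j * X         ≤⟨ bound ⟩
  15 ^ j * N        ∎)
  where open ≤-Reasoning

count≡0⇒count-not≡length : ∀ (p : A → Bool) xs → count p xs ≡ 0 → count (not ∘ p) xs ≡ length xs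
count≡0⇒count-not≡length p xs none =
  trans (sym (+-identityʳ _)) (trans (cong (count (not ∘ p) xs +_) (sym none)) (count-complement p xs))

hitting-set : ∀ (H : A → B → Bool) (U : List A) (Q : List B) e j →
  15 ^ j * 2 ^ e ≤ 16 ^ j → 0 < length U → length Q < 2 ^ e →
  (∀ {q} → q ∈ Q → length U ≤ 8 * count (λ u → H u q) U) →
  ∃ λ P → length P ≡ j × (∀ {q} → q ∈ Q → ∃ λ p → p ∈ P × H p q ≡ true)
hitting-set H (u₀ ∷ us) Q e j growth _ Q<2^e dense =
  let P , len , bound = multiplicative-weights H Q 8 15 refl (dense⇒average-hit H u₀ us Q dense) j
  in P , len , λ {q} q∈ → count>0⇒∃ (λ p → H p q) P (n≢0⇒n>0 λ none →
       <⇒≱ Q<2^e (unhit⇒large j e _ _ growth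
         (≤-trans
           (≤-reflexive (cong (2 ^_) (sym (trans (count≡0⇒count-not≡length (λ p → H p q) P none) len))))
           (∈⇒≤∑ (λ q → 2 ^ count (λ p → not (H p q)) P) q∈))
         bound))

-- Blocks of thresholds in one coordinate.

≤ᵇ-true : ∀ {m n} → m ≤ n → (m ≤ᵇ n) ≡ true
≤ᵇ-true = Equivalence.to T-≡ ∘ ≤⇒≤ᵇ

≤ᵇ-false : ∀ {m n} → n < m → (m ≤ᵇ n) ≡ false
≤ᵇ-false {m} {n} n<m = ¬-not λ eq → <⇒≱ n<m (≤ᵇ⇒≤ m n (Equivalence.from T-≡ eq))

true⇒≤ : ∀ {m n} → (m ≤ᵇ n) ≡ true → m ≤ n
true⇒≤ {m} {n} = ≤ᵇ⇒≤ m n ∘ Equivalence.from T-≡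

false⇒> : ∀ {m n} → (m ≤ᵇ n) ≡ false → n < m
false⇒> eq = ≰⇒> λ m≤n → contradiction (trans (sym (≤ᵇ-true m≤n)) eq) λ ()

-- Thresholds y are grouped into blocks according to how many members of U lie below y in the
-- coordinate ρ. A member u is bad for the block β if ρ u and ρ u + 1 both lie in β, so that β may
-- have thresholds on either side of u; otherwise above β u tells on which side all of β lies.
module Blocks {A : Set a} (ρ : A → ℕ) (U : List A) (K : ℕ) {{_ : NonZero K}} where

  below : ℕ → ℕ
  below y = count (λ u → suc (ρ u) ≤ᵇ y) U

  block : ℕ → ℕ
  block y = below y / K

  above : ℕ → A → Bool
  above β u = suc β ≤ᵇ block (suc (ρ u))

  bad : ℕ → A → Bool
  bad β u = not (above β u) ∧ (β ≤ᵇ block (ρ u))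

  below-mono : ∀ {y z} → y ≤ z → below y ≤ below z
  below-mono y≤z = ∑-mono U λ _ → bit-≤ λ eq →
    ≤-reflexive (cong bit (sym (≤ᵇ-true (≤-trans (true⇒≤ eq) y≤z))))

  block-mono : ∀ {y z} → y ≤ z → block y ≤ block z
  block-mono y≤z = /-monoˡ-≤ K (below-mono y≤z)

  block-< : ∀ {M} → length U < M * K → ∀ y → block y < M
  block-< U<MK y = m<n*o⇒m/o<n (≤-<-trans below≤length U<MK)
    where
    below≤length : below y ≤ length U
    below≤length = ≤-trans (m≤n+m (below y) _) (≤-reflexive (count-complement _ U))

  -- Both cases follow from monotonicity of `block`; when `above` is false, not being bad gives
  -- `block (ρ u) < block y`, which excludes `y ≤ ρ u`.
  above-correct : ∀ y u → bad (block y) u ≡ false → above (block y) u ≡ (y ≤ᵇ ρ u)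
  above-correct y u ¬bad with above (block y) u in eq
  ... | true  = sym (≤ᵇ-true (≮⇒≥ λ u<y → <⇒≱ (true⇒≤ eq) (block-mono {suc (ρ u)} {y} u<y)))
  ... | false = sym (≤ᵇ-false (≰⇒> λ y≤u → <⇒≱ (false⇒> ¬bad) (block-mono {y} {ρ u} y≤u)))

  -- Let `lo` and `hi` be bad members with least and greatest `ρ`. All bad members are counted by
  -- `below (suc (ρ hi)) < suc β * K` and none by `below (ρ lo) ≥ β * K`, so there are fewer than
  -- `K` of them.
  few-bad : ∀ β → count (bad β) U ≤ K
  few-bad β with filterᵇ (bad β) U in eq
  ... | [] = ≤-trans (∑-mono U λ u∈ → bit-≤ λ is-bad →
                contradiction (subst (_ ∈_) eq (∈-filter⁺ (T? ∘ bad β) u∈ (Equivalence.from T-≡ is-bad))) λ ())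
              (≤-trans (≤-reflexive (trans (∑-const U 0) (*-zeroʳ (length U)))) z≤n)
  ... | g ∷ gs with ∃-argmin ρ g gs | ∃-argmax ρ g gs
  ... | lo , lo∈ , lo≤ | hi , hi∈ , ≤hi = <⇒≤ (+-cancelʳ-< (β * K) _ _ (begin-strict
      count (bad β) U + β * K        ≤⟨ +-monoʳ-≤ _ (≤-trans (*-monoˡ-≤ K (proj₂ (bounds lo∈))) (m/n*n≤m _ K)) ⟩
      count (bad β) U + below (ρ lo) ≡⟨ ∑-+ U _ _ ⟨
      ∑ U (λ u → bit (bad β u) + bit (suc (ρ u) ≤ᵇ ρ lo)) ≤⟨ ∑-mono U between ⟩
      below (suc (ρ hi))             <⟨ ≰⇒> (λ ge → <⇒≱ (proj₁ (bounds hi∈))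
                                          (≤-trans (≤-reflexive (sym (m*n/n≡m (suc β) K))) (/-monoˡ-≤ K ge))) ⟩
      suc β * K                      ∎))
    where
    open ≤-Reasoning
    is-bad : ∀ {u} → u ∈ g ∷ gs → bad β u ≡ true
    is-bad u∈ = Equivalence.to T-≡ (proj₂ (∈-filter⁻ (T? ∘ bad β) {xs = U} (subst (_ ∈_) (sym eq) u∈)))
    bounds : ∀ {u} → u ∈ g ∷ gs → block (suc (ρ u)) < suc β × β ≤ block (ρ u)
    bounds {u} u∈ with above β u in eq₁ | is-bad u∈
    ... | false | eq₂ = false⇒> eq₁ , true⇒≤ eq₂
    u∈G : ∀ {u} → u ∈ U → bad β u ≡ true → u ∈ g ∷ gs
    u∈G u∈ eq₁ = subst (_ ∈_) eq (∈-filter⁺ (T? ∘ bad β) u∈ (Equivalence.from T-≡ eq₁))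
    between : ∀ {u} → u ∈ U → bit (bad β u) + bit (suc (ρ u) ≤ᵇ ρ lo) ≤ bit (suc (ρ u) ≤ᵇ suc (ρ hi))
    between {u} u∈ with bad β u in eq₁
    ... | true  rewrite ≤ᵇ-false (s≤s (lo≤ (u∈G u∈ eq₁))) | ≤ᵇ-true (s≤s (≤hi (u∈G u∈ eq₁))) = ≤-refl
    ... | false = bit-≤ λ u<lo →
      ≤-reflexive (cong bit (sym (≤ᵇ-true (≤-trans (true⇒≤ u<lo) (m≤n⇒m≤1+n (lo≤ hi∈))))))

-- Enumeration of the cells.

vectors : ℕ → ∀ d → List (Vec ℕ d)
vectors M zero    = [] ∷ []
vectors M (suc d) = cartesianProductWith _∷_ (upTo M) (vectors M d)

length-cartesianProductWith : ∀ {c} {C : Set c} (f : A → B → C) xs ys →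
  length (cartesianProductWith f xs ys) ≡ length xs * length ys
length-cartesianProductWith f []       ys = refl
length-cartesianProductWith f (x ∷ xs) ys = trans (Listₚ.length-++ (map (f x) ys))
  (cong₂ _+_ (Listₚ.length-map (f x) ys) (length-cartesianProductWith f xs ys))

length-vectors : ∀ M d → length (vectors M d) ≡ M ^ d
length-vectors M zero    = refl
length-vectors M (suc d) = trans (length-cartesianProductWith _∷_ (upTo M) (vectors M d))
  (cong₂ _*_ (Listₚ.length-upTo M) (length-vectors M d))

∈-vectors : ∀ {M d} (f : Fin d → ℕ) → (∀ i → f i < M) → tabulate f ∈ vectors M d
∈-vectors {d = zero}  f f<M = here refl
∈-vectors {d = suc d} f f<M = ∈-cartesianProductWith⁺ _∷_ (∈-upTo⁺ (f<M zero)) (∈-vectors (f ∘ suc) (f<M ∘ suc))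

tabulate-const : ∀ {d} {f : Fin d → A} {x} → (∀ i → f i ≡ x) → tabulate f ≡ replicate d x
tabulate-const {d = zero}  f≡x = refl
tabulate-const {d = suc d} f≡x = cong₂ _∷_ (f≡x zero) (tabulate-const (f≡x ∘ suc))

does-∧ : ∀ {P : Set a} (P? : Dec P) {x} → does P? ∧ x ≡ true → P × x ≡ true
does-∧ (yes p) eq = p , eq

-- Small dominating sets in the tournament of the selected quadrants.

module Domination {n d : ℕ} (r : Fin d → Fin n → ℕ) (r-injective : ∀ i {u v} → r i u ≡ r i v → u ≡ v)
                  (half : Vec Bool d → Bool) (half-antipodal : ∀ σ → half (Vec.map not σ) ≡ not (half σ)) where

  -- Ties only occur between a point and itself. They count as positive exactly when the all-positive
  -- quadrant is selected, so that every point dominates itself.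
  tie : ℕ
  tie = if half (replicate d true) then 0 else 1

  threshold : Fin d → Fin n → ℕ
  threshold i v = tie + r i v

  sign : Fin n → Fin n → Vec Bool d
  sign u v = tabulate λ i → threshold i v ≤ᵇ r i u

  D : Fin n → Fin n → Bool
  D u v = half (sign u v)

  half-negative : half (replicate d false) ≡ not (half (replicate d true))
  half-negative = trans (cong half (sym (Vecₚ.map-replicate not true d))) (half-antipodal (replicate d true))

  D-refl : ∀ v → D v v ≡ true
  D-refl v with half (replicate d true) in eq
  ... | true  = trans (cong half (tabulate-const λ i → ≤ᵇ-true (≤-refl {r i v}))) eq
  ... | false = trans (cong half (tabulate-const λ i → ≤ᵇ-false (n<1+n (r i v)))) (trans half-negative (cong not eq))

  -- For distinct ranks, comparing with or without the shift by `tie` gives the same answer.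
  tie-swap : ∀ {x y} → x ≢ y → (tie + x ≤ᵇ y) ≡ not (tie + y ≤ᵇ x)
  tie-swap {x} {y} x≢y with half (replicate d true) | <-cmp x y
  ... | true  | tri< x<y _ _ = trans (≤ᵇ-true (<⇒≤ x<y)) (cong not (sym (≤ᵇ-false x<y)))
  ... | true  | tri≈ _ x≡y _ = ⊥-elim (x≢y x≡y)
  ... | true  | tri> _ _ y<x = trans (≤ᵇ-false y<x) (cong not (sym (≤ᵇ-true (<⇒≤ y<x))))
  ... | false | tri< x<y _ _ = trans (≤ᵇ-true x<y) (cong not (sym (≤ᵇ-false (m<n⇒m<1+n x<y))))
  ... | false | tri≈ _ x≡y _ = ⊥-elim (x≢y x≡y)
  ... | false | tri> _ _ y<x = trans (≤ᵇ-false (m<n⇒m<1+n y<x)) (cong not (sym (≤ᵇ-true y<x)))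

  sign-antipodal : ∀ {u v} → u ≢ v → sign u v ≡ Vec.map not (sign v u)
  sign-antipodal u≢v = trans (Vecₚ.tabulate-cong λ i → tie-swap (u≢v ∘ sym ∘ r-injective i)) (Vecₚ.tabulate-∘ not _)

  complete : ∀ u v → D u v ≡ true ⊎ D v u ≡ true
  complete u v with u Finₚ.≟ v
  ... | yes refl = inj₁ (D-refl u)
  ... | no u≢v with D v u in eq
  ... | true  = inj₂ refl
  ... | false = inj₁ (trans (cong half (sign-antipodal u≢v)) (trans (half-antipodal (sign v u)) (cong not eq)))

  module Cells (U : List (Fin n)) {{_ : NonZero n}} where

    -- Block size `n` balances two counts: a list `U` of length `16dn` makes at most `16d + 1`
    -- blocks per coordinate, and the bad members over all `d` coordinates number at most `dn`.
    module Coordinate (i : Fin d) = Blocks (r i) U n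
    open Coordinate

    predicted : Fin n → Vec ℕ d → Vec Bool d
    predicted u β = tabulate λ i → above i (lookup β i) u

    all-good? : ∀ u β → Dec (∀ i → bad i (lookup β i) u ≡ false)
    all-good? u β = all? λ i → bad i (lookup β i) u Boolₚ.≟ false

    dominates-cell : Fin n → Vec ℕ d → Bool
    dominates-cell u β = does (all-good? u β) ∧ half (predicted u β)

    cell : Fin n → Vec ℕ d
    cell v = tabulate λ i → block i (threshold i v)

    predicted-correct : ∀ u v → (∀ i → bad i (lookup (cell v) i) u ≡ false) → predicted u (cell v) ≡ sign u v
    predicted-correct u v good = Vecₚ.tabulate-cong λ i →
      subst (λ β → bad i β u ≡ false → above i β u ≡ (threshold i v ≤ᵇ r i u))
        (sym (Vecₚ.lookup∘tabulate _ i)) (above-correct i (threshold i v) u) (good i)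

    dominates-cell⇒D : ∀ u v → dominates-cell u (cell v) ≡ true → D u v ≡ true
    dominates-cell⇒D u v eq with good , eq ← does-∧ (all-good? u (cell v)) eq =
      trans (cong half (sym (predicted-correct u v good))) eq

    -- A union bound: if no coordinate is bad, the prediction from the cell is the true sign vector;
    -- otherwise a bad coordinate contributes 1 to the sum.
    D-split : ∀ u v → bit (D u v) ≤
      bit (dominates-cell u (cell v)) + ∑ (allFin d) (λ i → bit (bad i (lookup (cell v) i) u))
    D-split u v with all-good? u (cell v)
    ... | yes good = ≤-trans (≤-reflexive (cong bit (sym (cong₂ _∧_ (dec-true (all-good? u (cell v)) good)
                                     (cong half (predicted-correct u v good)))))) (m≤m+n _ _)
    ... | no ¬good with i , ¬bad ← Finₚ.¬∀⟶∃¬ d _ (λ i → bad i (lookup (cell v) i) u Boolₚ.≟ false) ¬good =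
      bit-≤ λ _ → ≤-trans (≤-reflexive (cong bit (sym (¬-not ¬bad))))
        (≤-trans (∈⇒≤∑ (λ i → bit (bad i (lookup (cell v) i) u)) (∈-allFin i)) (m≤n+m _ _))

    dominators≤ : ∀ v → count (λ u → D u v) U ≤ count (λ u → dominates-cell u (cell v)) U + d * n
    dominators≤ v = begin
      count (λ u → D u v) U
        ≤⟨ ∑-mono U (λ {u} _ → D-split u v) ⟩
      ∑ U (λ u → bit (dominates-cell u (cell v)) + bads u)
        ≡⟨ ∑-+ U _ bads ⟩
      C + ∑ U bads
        ≡⟨ cong (C +_) (∑-swap U (allFin d) _) ⟩
      C + ∑ (allFin d) (λ i → count (bad i (lookup (cell v) i)) U)
        ≤⟨ +-monoʳ-≤ C (∑-mono (allFin d) λ {i} _ → few-bad i (lookup (cell v) i)) ⟩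
      C + ∑ (allFin d) (λ _ → n)
        ≡⟨ cong (C +_) (trans (∑-const (allFin d) n) (cong (_* n) (Listₚ.length-tabulate {n = d} id))) ⟩
      C + d * n
        ∎
      where
      open ≤-Reasoning
      C = count (λ u → dominates-cell u (cell v)) U
      bads = λ u → ∑ (allFin d) (λ i → bit (bad i (lookup (cell v) i) u))

  module _ {{n≢0 : NonZero n}} where
    open Cells
    open Coordinate using (block-<)

    -- With `N = d * n`, at least `4N - n ≥ 3N` members of `U` dominate `v`, and at most `N` of
    -- these are lost to bad blocks. The `2N` left are an eighth of `16N`.
    dense-cells : ∀ U v → length U ≡ 4 * (4 * (d * n)) → 0 < d → 4 * (d * n) ≤ count (λ u → D u v) U + n →
      length U ≤ 8 * count (λ u → dominates-cell U u (cell U v)) U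
    dense-cells U v len 0<d many = begin
      length U               ≡⟨ trans len (r₁ N) ⟩
      8 * (N + N)            ≤⟨ *-monoʳ-≤ 8 {N + N} {C} (+-cancelʳ-≤ (N + N) (N + N) C (begin
        N + N + (N + N)        ≡⟨ r₂ N ⟩
        4 * N                  ≤⟨ many ⟩
        count (λ u → D u v) U + n ≤⟨ +-mono-≤ (dominators≤ U v) (m≤n*m n d {{>-nonZero 0<d}}) ⟩
        C + N + N              ≡⟨ +-assoc C N N ⟩
        C + (N + N)            ∎)) ⟩
      8 * C                  ∎
      where
      open ≤-Reasoning
      N = d * n
      C = count (λ u → dominates-cell U u (cell U v)) U
      r₁ : ∀ x → 4 * (4 * x) ≡ 8 * (x + x)
      r₁ = solve-∀
      r₂ : ∀ x → x + x + (x + x) ≡ 4 * x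
      r₂ = solve-∀

    -- The elements to be hit are the block vectors dominated by at least an eighth of `U`. They
    -- include the cell of every vertex, and their number is bounded independently of `n`.
    dominating-set : ∀ e → 0 < d → suc (16 * d) ^ d < 2 ^ e →
      ∃ λ P → length P ≡ 11 * e × (∀ v → ∃ λ p → p ∈ P × D p v ≡ true)
    dominating-set e 0<d few-cells =
      let P , lenP , hit = hitting-set (dominates-cell U) U Q e (11 * e) (15^11e*2^e≤16^11e e)
                             (subst (0 <_) (sym len) 0<T) (≤-<-trans Q≤ few-cells)
                             (proj₂ ∘ ∈-filter⁻ heavy? {xs = vectors M d})
      in P , lenP , λ v →
        let p , p∈P , p-hits = hit (∈-filter⁺ heavy? (∈-vectors _ (λ i → block-< U i U<M*n (threshold i v)))
                                      (dense-cells U v len 0<d (proj₂ (proj₂ sample) v)))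
        in p , p∈P , dominates-cell⇒D U p v p-hits
      where
      N = d * n
      -- One more than `16 * d`, because `block-<` needs `length U = 16 * d * n` to be strictly
      -- below `M * n`.
      M = suc (16 * d)
      sample : ∃ λ U → length U ≡ 4 * (4 * N) × (∀ v → 4 * N ≤ count (λ u → D u v) U + n)
      sample = fractional n D complete
        where
        fractional : ∀ n (D : Fin n → Fin n → Bool) (complete : ∀ u v → D u v ≡ true ⊎ D v u ≡ true)
          .{{_ : NonZero n}} →
          ∃ λ U → length U ≡ 4 * (4 * N) × (∀ v → 4 * N ≤ count (λ u → D u v) U + n)
        fractional (suc n) D complete
          with U , len , many ← fractional-domination D complete zero (List.tabulate suc) (4 * N) =
          U , len , λ v → subst (λ l → 4 * N ≤ count (λ u → D u v) U + l)
            (cong suc (Listₚ.length-tabulate {n = n} suc)) (many (∈-allFin v))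
      U = proj₁ sample
      len : length U ≡ 4 * (4 * N)
      len = proj₁ (proj₂ sample)
      0<T : 0 < 4 * (4 * N)
      0<T = *-mono-< {0} {4} z<s (*-mono-< {0} {4} z<s (*-mono-< 0<d (>-nonZero⁻¹ n)))
      U<M*n : length U < M * n
      U<M*n = subst (_< M * n) (sym (trans len (r₁ d n))) (m<n+m (16 * d * n) (>-nonZero⁻¹ n))
        where
        r₁ : ∀ x y → 4 * (4 * (x * y)) ≡ 16 * x * y
        r₁ = solve-∀
      heavy? : ∀ β → Dec (length U ≤ 8 * count (λ u → dominates-cell U u β) U)
      heavy? β = length U ≤? 8 * count (λ u → dominates-cell U u β) U
      Q = filter heavy? (vectors M d)
      Q≤ : length Q ≤ M ^ d
      Q≤ = ≤-trans (Listₚ.length-filter heavy? (vectors M d)) (≤-reflexive (length-vectors M d))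

-- Choices of one quadrant from each antipodal pair.

length-concatMap-const : ∀ {k} (f : A → List B) → (∀ x → length (f x) ≡ k) →
  ∀ xs → length (concatMap f xs) ≡ length xs * k
length-concatMap-const f len []       = refl
length-concatMap-const f len (x ∷ xs) =
  trans (Listₚ.length-++ (f x)) (cong₂ _+_ (len x) (length-concatMap-const f len xs))

-- Functions Vec Bool m → Bool, tabulated as binary trees so that they can be enumerated.
Choice : ℕ → Set
Choice zero    = Bool
Choice (suc m) = Choice m × Choice m

choose : ∀ {m} → Choice m → Vec Bool m → Bool
choose c       []          = c
choose (c , _) (true  ∷ τ) = choose c τ
choose (_ , c) (false ∷ τ) = choose c τ

choices : ∀ m → List (Choice m)
choices zero    = true ∷ false ∷ []
choices (suc m) = cartesianProductWith _,_ (choices m) (choices m)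

length-choices : ∀ m → length (choices m) ≡ 2 ^ (2 ^ m)
length-choices zero    = refl
length-choices (suc m) = begin
  length (choices (suc m))                ≡⟨ length-cartesianProductWith _,_ (choices m) (choices m) ⟩
  length (choices m) * length (choices m) ≡⟨ cong₂ _*_ (length-choices m) (length-choices m) ⟩
  2 ^ (2 ^ m) * 2 ^ (2 ^ m)               ≡⟨ ^-distribˡ-+-* 2 (2 ^ m) (2 ^ m) ⟨
  2 ^ (2 ^ m + 2 ^ m)                     ≡⟨ cong (λ z → 2 ^ (2 ^ m + z)) (+-identityʳ (2 ^ m)) ⟨
  2 ^ (2 ^ suc m)                         ∎
  where open ≡-Reasoning

∈-choices : ∀ {m} (c : Choice m) → c ∈ choices m
∈-choices {zero}  true      = here refl
∈-choices {zero}  false     = there (here refl)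
∈-choices {suc m} (c₁ , c₂) = ∈-cartesianProductWith⁺ _,_ (∈-choices c₁) (∈-choices c₂)

-- Finite choice over the cube, with the choice function in its encoded form, hence a member of
-- `choices m`.
choose-all : ∀ {p m} (P : Vec Bool m → Bool → Set p) → (∀ τ → P τ true ⊎ P τ false) →
             Σ (Choice m) λ c → ∀ τ → P τ (choose c τ)
choose-all {m = zero} P split with split []
... | inj₁ p = true , λ { [] → p }
... | inj₂ p = false , λ { [] → p }
choose-all {m = suc m} P split
  with choose-all (λ τ → P (true ∷ τ)) (split ∘ (true ∷_))
     | choose-all (λ τ → P (false ∷ τ)) (split ∘ (false ∷_))
... | c₁ , h₁ | c₂ , h₂ = (c₁ , c₂) , λ { (true ∷ τ) → h₁ τ ; (false ∷ τ) → h₂ τ }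

-- An antipodal pair is indexed by the tail `τ` of its member with first sign `true`; `choose c τ`
-- tells whether that member or its antipode is selected.
half-of : ∀ {m} → Choice m → Vec Bool (suc m) → Bool
half-of c (true  ∷ τ) = choose c τ
half-of c (false ∷ τ) = not (choose c (Vec.map not τ))

map-not-involutive : ∀ {m} (σ : Vec Bool m) → Vec.map not (Vec.map not σ) ≡ σ
map-not-involutive σ = trans (sym (Vecₚ.map-∘ not not σ)) (trans (Vecₚ.map-cong not-involutive σ) (Vecₚ.map-id σ))

half-of-antipodal : ∀ {m} (c : Choice m) σ → half-of c (Vec.map not σ) ≡ not (half-of c σ)
half-of-antipodal c (true  ∷ τ) = cong (not ∘ choose c) (map-not-involutive τ)
half-of-antipodal c (false ∷ τ) = sym (not-involutive _)

quadrant : ∀ {m} → Vec Bool m → Bool → Vec Bool (suc m)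
quadrant τ true  = true ∷ τ
quadrant τ false = false ∷ Vec.map not τ

half-of-quadrant : ∀ {m} (c : Choice m) σ → half-of c σ ≡ true → ∃ λ τ → quadrant τ (choose c τ) ≡ σ
half-of-quadrant c (true ∷ τ) eq = τ , cong (quadrant τ) eq
half-of-quadrant c (false ∷ τ) eq = Vec.map not τ ,
  trans (cong (quadrant (Vec.map not τ)) (trans (sym (not-involutive _)) (cong not eq)))
    (cong (false ∷_) (map-not-involutive τ))

-- Closed quadrants and the boxes they span.

InQuadrant : ∀ {n d} → (Fin d → Fin n → ℕ) → Vec Bool d → Fin n → Fin n → Set
InQuadrant r σ p v = ∀ i → if lookup σ i then r i v ≤ r i p else r i p ≤ r i v

inQuadrant? : ∀ {n d} (r : Fin d → Fin n → ℕ) σ p v → Dec (InQuadrant r σ p v)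
inQuadrant? r σ p v = all? decide
  where
  decide : ∀ i → Dec (if lookup σ i then r i v ≤ r i p else r i p ≤ r i v)
  decide i with lookup σ i
  ... | true  = r i v ≤? r i p
  ... | false = r i p ≤? r i v

module _ {n d : ℕ} (r : Fin d → Fin n → ℕ) where

  Between : Fin n → Fin n → Fin n → Set
  Between p q v = ∀ i → (r i p ≤ r i v × r i v ≤ r i q) ⊎ (r i q ≤ r i v × r i v ≤ r i p)

  opposite-quadrants⇒between : ∀ σ {p q v} → InQuadrant r σ p v → InQuadrant r (Vec.map not σ) q v → Between p q v
  opposite-quadrants⇒between σ p∈ q∈ i
    with lookup σ i | lookup (Vec.map not σ) i | Vecₚ.lookup-map i not σ | p∈ i | q∈ i
  ... | true  | .false | refl | v≤p | q≤v = inj₂ (q≤v , v≤p)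
  ... | false | .true  | refl | p≤v | v≤q = inj₁ (p≤v , v≤q)

module _ {n d : ℕ} (r : Fin d → Fin n → ℕ) (r-injective : ∀ i {u v} → r i u ≡ r i v → u ≡ v)
         (half : Vec Bool d → Bool) (half-antipodal : ∀ σ → half (Vec.map not σ) ≡ not (half σ)) where
  open Domination r r-injective half half-antipodal

  tie≤1 : tie ≤ 1
  tie≤1 with half (replicate d true)
  ... | true  = z≤n
  ... | false = ≤-refl

  sign-inQuadrant : ∀ u v → InQuadrant r (sign u v) u v
  sign-inQuadrant u v i with lookup (sign u v) i | Vecₚ.lookup∘tabulate (λ i → threshold i v ≤ᵇ r i u) i
  ... | true  | eq = ≤-trans (m≤n+m (r i v) tie) (true⇒≤ (sym eq))
  -- The shift is at most 1, so `r i u < tie + r i v` still yields the weak inequality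
  -- `r i u ≤ r i v`.
  ... | false | eq = s≤s⁻¹ (≤-trans (false⇒> (sym eq)) (+-monoˡ-≤ (r i v) tie≤1))

-- Union of the dominating sets over all choices.

module _ {n m : ℕ} {{_ : NonZero n}} (r : Fin (suc m) → Fin n → ℕ) (inj : ∀ i {u v} → r i u ≡ r i v → u ≡ v) where

  private module Dom (c : Choice m) = Domination r inj (half-of c) (half-of-antipodal c)

  module Union (k : ℕ) (dominators : (c : Choice m) →
      ∃ λ P → length P ≡ k × (∀ v → ∃ λ p → p ∈ P × Dom.D c p v ≡ true)) where

    P = concatMap (proj₁ ∘ dominators) (choices m)

    lenP : length P ≡ 2 ^ (2 ^ m) * k
    lenP = trans (length-concatMap-const _ (proj₁ ∘ proj₂ ∘ dominators) (choices m)) (cong (_* k) (length-choices m))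

    Goal : Fin n → Set
    Goal v = ∃ λ p → ∃ λ q → p ∈ P × q ∈ P × Between r p q v

    Empty : Fin n → Vec Bool (suc m) → Set
    Empty v σ = ¬ Any (λ p → InQuadrant r σ p v) P

    -- Points of `P` in two opposite quadrants at `v` span a box around `v`. Keeping `Goal v` as an
    -- alternative under both signs lets `choose-all` run without first deciding whether `v` is
    -- covered.
    dichotomy : ∀ v τ → (Goal v ⊎ Empty v (quadrant τ true)) ⊎ (Goal v ⊎ Empty v (quadrant τ false))
    dichotomy v τ with any? (λ p → inQuadrant? r (quadrant τ true) p v) P
                     | any? (λ p → inQuadrant? r (quadrant τ false) p v) P
    ... | no ¬p | _     = inj₁ (inj₂ ¬p)
    ... | yes _ | no ¬q = inj₂ (inj₂ ¬q)
    ... | yes p | yes q with find p | find q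
    ... | p , p∈ , hp | q , q∈ , hq = inj₁ (inj₁ (p , q , p∈ , q∈ , opposite-quadrants⇒between r (true ∷ τ) hp hq))

    covered : ∀ v → Goal v
    covered v with choose-all (λ τ b → Goal v ⊎ Empty v (quadrant τ b)) (dichotomy v)
    ... | c , empties with proj₂ (proj₂ (dominators c)) v
    ... | p , p∈ , Dpv with half-of-quadrant c (Dom.sign c p v) Dpv
    ... | τ , eq with empties τ
    ... | inj₁ goal  = goal
    -- The dominator `p` belongs to `P`, as `c` is among the enumerated choices, and lies in the
    -- very quadrant that `c` declares empty.
    ... | inj₂ empty = ⊥-elim (empty (lose
      (∈-concat⁺′ p∈ (∈-map⁺ (proj₁ ∘ dominators) (∈-choices c)))
      (subst (λ σ → InQuadrant r σ p v) (sym eq) (sign-inQuadrant r inj (half-of c) (half-of-antipodal c) p v))))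

  covering-ranks : ∀ e → suc (16 * suc m) ^ suc m < 2 ^ e →
    ∃ λ P → length P ≡ 2 ^ (2 ^ m) * (11 * e) ×
      (∀ v → ∃ λ p → ∃ λ q → p ∈ P × q ∈ P × Between r p q v)
  covering-ranks e few-cells = P , lenP , covered
    where open Union (11 * e) (λ c → Dom.dominating-set c e z<s few-cells)

-- Estimates for the number of cells and the size of the cover.

n<2^1+⌊log₂n⌋ : ∀ n → n < 2 ^ suc ⌊log₂ n ⌋
n<2^1+⌊log₂n⌋ n = ≰⇒> λ 2^≤n →
  1+n≰n (≤-trans (≤-reflexive (sym (⌊log₂[2^n]⌋≡n (suc ⌊log₂ n ⌋)))) (⌊log₂⌋-mono-≤ 2^≤n))

-- Each coordinate costs `5 + ⌊log₂ d⌋` bits, from `16d + 1 ≤ 16(d + 1)`; the outer `suc` makes the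
-- inequality strict.
number-of-cells : ∀ d → suc (16 * d) ^ d < 2 ^ suc ((4 + suc ⌊log₂ d ⌋) * d)
number-of-cells d = begin-strict
  suc (16 * d) ^ d            ≤⟨ ^-monoˡ-≤ d one-coordinate ⟩
  (2 ^ (4 + suc L)) ^ d       ≡⟨ ^-*-assoc 2 (4 + suc L) d ⟩
  2 ^ ((4 + suc L) * d)       <⟨ ^-monoʳ-< 2 (s≤s (s≤s z≤n)) (n<1+n ((4 + suc L) * d)) ⟩
  2 ^ suc ((4 + suc L) * d)   ∎
  where
  open ≤-Reasoning
  L = ⌊log₂ d ⌋
  one-coordinate : suc (16 * d) ≤ 2 ^ (4 + suc L)
  one-coordinate = begin
    suc (16 * d)       ≤⟨ +-monoˡ-≤ (16 * d) {1} {16} (s≤s z≤n) ⟩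
    16 + 16 * d        ≡⟨ *-suc 16 d ⟨
    16 * suc d         ≤⟨ *-monoʳ-≤ 16 (n<2^1+⌊log₂n⌋ d) ⟩
    16 * 2 ^ suc L     ≡⟨ ^-distribˡ-+-* 2 4 (suc L) ⟨
    2 ^ (4 + suc L)    ∎

-- The constant is `11 * 7`: the terms `1`, `5d` and `Ld` are at most `Ld`, `5Ld` and `Ld`.
size-bound : ∀ x d L → 1 ≤ d → 1 ≤ L → x * (11 * suc ((4 + suc L) * d)) ≤ 77 * (x * d * L)
size-bound x d L 1≤d 1≤L = begin
  x * (11 * suc ((4 + suc L) * d))          ≡⟨ r₁ x d L ⟩
  11 * x * (1 + 5 * d + L * d)              ≤⟨ *-monoʳ-≤ (11 * x) (+-monoˡ-≤ (L * d)
                                                 (+-mono-≤ (≤-trans 1≤d d≤L*d) (*-monoʳ-≤ 5 d≤L*d))) ⟩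
  11 * x * (L * d + 5 * (L * d) + L * d)    ≡⟨ r₂ x d L ⟩
  77 * (x * d * L)                          ∎
  where
  open ≤-Reasoning
  d≤L*d : d ≤ L * d
  d≤L*d = m≤n*m d L {{>-nonZero 1≤L}}
  r₁ : ∀ x d L → x * (11 * suc ((4 + suc L) * d)) ≡ 11 * x * (1 + 5 * d + L * d)
  r₁ = solve-∀
  r₂ : ∀ x d L → 11 * x * (L * d + 5 * (L * d) + L * d) ≡ 77 * (x * d * L)
  r₂ = solve-∀

-- Passage from a total order to integer ranks.

module _ {c ℓ₁ ℓ₂ : Level} (O : TotalOrder c ℓ₁ ℓ₂) where
  open TotalOrder O using (total) renaming (Carrier to R; _≤_ to _≼_; trans to ≼-trans)
  open Boxes O

  -- Equal coordinates, and even repeated points, receive distinct ranks, which puts the points in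
  -- general position; `reflects` carries boxes of ranks back to boxes in `O`.
  record Ranking {n} (x : Fin n → R) : Set ℓ₂ where
    field
      rank      : Fin n → ℕ
      injective : ∀ {j k} → rank j ≡ rank k → j ≡ k
      reflects  : ∀ {j k} → rank j ≤ rank k → x j ≼ x k

  -- Insertion of the first point, guided only by the answers of `total`. The cut lies just above
  -- the highest-ranked point that `total` places below the new one. Lower ranks are below it by
  -- transitivity; ranks from the cut on were all placed above it.
  ranking : ∀ {n} (x : Fin n → R) → Ranking x
  ranking {zero}  x = record { rank = λ () ; injective = λ { {()} } ; reflects = λ { {()} } }
  ranking {suc n} x = record { rank = rank′ ; injective = injective′ ; reflects = reflects′ }
    where
    open Ranking (ranking (x ∘ suc))

    bound-from : Fin (suc n) → ℕ
    bound-from zero    = 0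
    bound-from (suc j) = [ (λ _ → suc (rank j)) , (λ _ → 0) ]′ (total (x (suc j)) (x zero))

    top : ∃ λ t → ∀ k → bound-from k ≤ bound-from t
    top with t , _ , max ← ∃-argmax bound-from zero (List.tabulate suc) = t , λ k → max (∈-allFin k)

    cut : ℕ
    cut = bound-from (proj₁ top)

    below-cut : ∀ j → rank j < cut → x (suc j) ≼ x zero
    below-cut j j< with proj₁ top
    ... | suc t with total (x (suc t)) (x zero)
    ... | inj₁ t≼0 = ≼-trans (reflects (s≤s⁻¹ j<)) t≼0

    above-cut : ∀ j → cut ≤ rank j → x zero ≼ x (suc j)
    above-cut j ≤j with total (x (suc j)) (x zero) | proj₂ top (suc j)
    ... | inj₂ 0≼j | _  = 0≼j
    ... | inj₁ _   | j< = ⊥-elim (<⇒≱ j< ≤j)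

    -- Doubling the old ranks makes room for the new point at every cut.
    rank′ : Fin (suc n) → ℕ
    rank′ zero    = 2 * cut
    rank′ (suc j) = suc (2 * rank j)

    injective′ : ∀ {j k} → rank′ j ≡ rank′ k → j ≡ k
    injective′ {zero}  {zero}  eq = refl
    injective′ {zero}  {suc k} eq = ⊥-elim (even≢odd cut (rank k) eq)
    injective′ {suc j} {zero}  eq = ⊥-elim (even≢odd cut (rank j) (sym eq))
    injective′ {suc j} {suc k} eq = cong suc (injective (*-cancelˡ-≡ (rank j) (rank k) 2 (suc-injective eq)))

    reflects′ : ∀ {j k} → rank′ j ≤ rank′ k → x j ≼ x k
    reflects′ {zero}  {zero}  _ = TotalOrder.refl O
    reflects′ {zero}  {suc k} h = above-cut k (≮⇒≥ λ k<cut →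
      <⇒≱ (≤-trans (≤-reflexive (sym (*-suc 2 (rank k)))) (*-monoʳ-≤ 2 k<cut)) h)
    reflects′ {suc j} {zero}  h = below-cut j (*-cancelˡ-< 2 (rank j) cut h)
    reflects′ {suc j} {suc k} h = reflects (*-cancelˡ-≤ 2 (s≤s⁻¹ h))

  module _ {d} (S : List (Point d)) where
    open module Coordinate (i : Fin d) = Ranking (ranking (λ j → List.lookup S j i))

    between⇒boxCover : ∀ P → (∀ v → ∃ λ p → ∃ λ q → p ∈ P × q ∈ P × Between rank p q v) →
                       BoxCover S (map (List.lookup S) P)
    between⇒boxCover P covers = members , covered
      where
      members : ∀ {p} → p ∈ map (List.lookup S) P → p ∈ S
      members p∈ with j , _ , refl ← ∈-map⁻ (List.lookup S) p∈ = ∈-lookup j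
      covered : ∀ {s} → s ∈ S → Σ (Point d) λ p → Σ (Point d) λ q →
                p ∈ map (List.lookup S) P × q ∈ map (List.lookup S) P × InBox p q s
      covered s∈ with covers (Any.index s∈)
      ... | p , q , p∈ , q∈ , btw = _ , _ , ∈-map⁺ _ p∈ , ∈-map⁺ _ q∈ ,
        subst (InBox _ _) (sym (lookup-index s∈)) λ i →
          Sum.map (Product.map (reflects i) (reflects i)) (Product.map (reflects i) (reflects i)) (btw i)

theorem1p7 : ∀ {c ℓ₁ ℓ₂ : Level} (O : TotalOrder c ℓ₁ ℓ₂) →
    Σ ℕ λ C → Σ ℕ λ d₀ → ∀ d → d₀ ≤ d →
    (S : List (Boxes.Point O d)) →
    Σ (List (Boxes.Point O d)) λ P → Boxes.BoxCover O S P × length P ≤ C * bound d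
-- From `d = 2` on `⌊log₂ d⌋` is at least 1, as `size-bound` requires.
theorem1p7 O = 77 , 2 , cover
  where
  cover : ∀ d → 2 ≤ d → (S : List (Boxes.Point O d)) →
    Σ (List (Boxes.Point O d)) λ P → Boxes.BoxCover O S P × length P ≤ 77 * bound d
  -- The tournament argument needs a vertex, so the empty set is covered separately.
  cover d         2≤d []         = [] , ((λ ()) , λ ()) , z≤n
  cover d@(suc m) 2≤d S@(_ ∷ _) = select (covering-ranks (Ranking.rank ∘ ranks) (Ranking.injective ∘ ranks)
                                    (suc ((4 + suc ⌊log₂ d ⌋) * d)) (number-of-cells d))
    where
    ranks : ∀ i → Ranking O (λ j → List.lookup S j i)
    ranks i = ranking O (λ j → List.lookup S j i)
    1≤log : 1 ≤ ⌊log₂ d ⌋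
    1≤log = ≤-trans (≤-reflexive (sym (⌊log₂[2^n]⌋≡n 1))) (⌊log₂⌋-mono-≤ 2≤d)
    select : (∃ λ P → length P ≡ 2 ^ (2 ^ m) * (11 * suc ((4 + suc ⌊log₂ d ⌋) * d)) ×
                (∀ v → ∃ λ p → ∃ λ q → p ∈ P × q ∈ P × Between (Ranking.rank ∘ ranks) p q v)) →
             Σ (List (Boxes.Point O d)) λ P → Boxes.BoxCover O S P × length P ≤ 77 * bound d
    select (P , len , covers) = map (List.lookup S) P , between⇒boxCover O S P covers ,
      ≤-trans (≤-reflexive (trans (Listₚ.length-map (List.lookup S) P) len))
        (size-bound (2 ^ (2 ^ m)) d ⌊log₂ d ⌋ (s≤s z≤n) 1≤log)
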